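{- Let $\kappa$ be a regular uncountable cardinal and $\lambda>\kappa$ a cardinal. Let $\rho$ be a cardinal with $2\le\rho\le\kappa$. Then: (i) $H^+\xrightarrow[\kappa]{\kappa}[H^+]^2_\rho$ for every ideal $H$ on $P_\kappa(\lambda)$ such that $\mathrm{cof}(H)<\mathbf{non}_\kappa(J^+\to[J^+]^2_\rho)$. (ii) If $I_{\kappa,\lambda}^+\xrightarrow[\kappa]{\kappa}[I_{\kappa,\lambda}^+]^2_\rho$, then $\sigma<\overline{\mathbf{non}}_\kappa(J^+\to[J^+]^2_\rho)$ for every $\sigma\in\mathcal K(\kappa,\lambda)$.
   Context: For a cardinal $\mu$ and a set $A$, $P_\mu(A)=\{a\subseteq A:|a|<\mu\}$. An ideal on an infinite set $S$ is a collection $K$ of subsets of $S$ containing all singletons, closed under subsets and finite unions, with $S\notin K$; $K^+=P(S)\setminus K$; $\mathrm{cof}(K)$ is the least cardinality of an $X\subseteq K$ with $K=\bigcup_{A\in X}P(A)$; $\overline{\mathrm{cof}}(K)$ is the least cardinality of an $X\subseteq K$ with $K=\bigcup\{P(\bigcup x):x\in P_\kappa(X)\}$. $K$ is $\kappa$-complete if it is closed under unions of fewer than $\kappa$ members. "Ideal on $\kappa$" always means $\kappa$-complete ideal on $\kappa$. $I_{\kappa,\lambda}$ is the set of all $A\subseteq P_\kappa(\lambda)$ such that $A\cap\{b\in P_\kappa(\lambda):a\subseteq b\}=\emptyset$ for some $a\in P_\kappa(\lambda)$. "Ideal on $P_\kappa(\lambda)$" always means a $\kappa$-complete ideal $H$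 on $P_\kappa(\lambda)$ that is fine ($I_{\kappa,\lambda}\subseteq H$). For $A\subseteq\kappa$, $[A]^2=\{(\xi,\eta)\in A\times A:\xi<\eta\}$. For an ideal $J$ on $\kappa$, $J^+\to[J^+]^2_\rho$ means: for every $A\in J^+$ and every $f:[A]^2\to\rho$ there is $B\in J^+\cap P(A)$ such that $f''[B]^2\neq\rho$. For a property $P$ failed by at least one ideal on $\kappa$, $\mathbf{non}_\kappa(P)$ (respectively $\overline{\mathbf{non}}_\kappa(P)$) is the least cardinal $\tau$ such that there is an ideal $J$ on $\kappa$ with $\mathrm{cof}(J)=\tau$ (respectively $\overline{\mathrm{cof}}(J)=\tau$) that does not satisfy $P$. For $A\subseteq P_\kappa(\lambda)$, $[A]^2_{\kappa,\kappa}=\{(\bigcup(a\cap\kappa),\bigcup(b\cap\kappa)):a,b\in A,\ \bigcup(a\cap\kappa)<\bigcup(b\cap\kappa)\}$. For an ideal $H$ on $P_\kappa(\lambda)$, $H^+\xrightarrow[\kappa]{\kappa}[H^+]^2_\rho$ means: for every $F:[P_\kappa(\lambda)]^2_{\kappa,\kappa}\to\rho$ and every $A\in H^+$ there is $B\in H^+\cap P(A)$ such that $F''[B]^2_{\kappa,\kappa}\ne\rho$. $\mathcal K(\kappa,\lambda)$ is the set of all cardinals $\sigma\ge\lambda$ for which there is $T\subseteq P_\kappa(\lambda)$ with $|T|=\sigma$ and $|T\cap P(a)|<\kappa$ for every $a\in P_\kappa(\lambda)$. -}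

module Defs where

open import Level using (Level; 0ℓ; _⊔_) renaming (suc to lsuc)
open import Data.Bool.Base using (Bool; T)
open import Data.Nat.Base using (ℕ)
open import Data.Product.Base using (_×_; _,_; ∃; ∃-syntax)
open import Data.Refinement using (Refinement; value)
open import Data.Sum.Base using (_⊎_)
open import Function.Base using (_∘_)
open import Function.Bundles using (_↣_; _⤖_; _⇔_)
open import Induction.WellFounded using (WellFounded)
open import Relation.Binary.Core using (Rel)
open import Relation.Binary.PropositionalEquality.Core using (_≡_)
open import Relation.Binary.Structures using (IsStrictTotalOrder)
open import Relation.Nullary.Negation.Core using (¬_)
open import Relation.Unary
  using (Pred; _∈_; _∉_; _⊆_; _≐_; _∪_; _∩_; ∁; U; ｛_｝; Universal; Empty)

private
  variable
    ℓ : Level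

-- Everything here is meant to be read under excluded middle and function
-- extensionality.  A subset that is itself a member of further
-- collections is a Bool-valued function: by excluded middle this is the
-- full power set, by extensionality two subsets with the same members
-- are equal, and the power set stays in `Set`.  Collections that are not
-- members of anything are `Pred`s.

𝒫 : Set → Set
𝒫 A = A → Bool

⟦_⟧ : {A : Set} → 𝒫 A → Pred A 0ℓ
⟦ a ⟧ = T ∘ a

-- A subset regarded as a type.  Membership proofs are irrelevant, so
-- elements are equal as soon as the underlying values are.

El : {A : Set} → Pred A 0ℓ → Set
El {A} P = Refinement A P

⋃₀ : {S : Set} → Pred (𝒫 S) 0ℓ → Pred S 0ℓ
⋃₀ x s = ∃[ B ] (B ∈ x × s ∈ ⟦ B ⟧)

_″_ : {A C : Set} {D : Pred A 0ℓ} → (El D → C) → Pred A 0ℓ → Pred C 0ℓ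
(f ″ R) c = ∃[ p ] (value p ∈ R × f p ≡ c)

infix 4 _≼_ _≺_

_≼_ : Set → Set → Set
A ≼ B = A ↣ B

_≺_ : Set → Set → Set
A ≺ B = (A ≼ B) × ¬ (B ≼ A)

-- A cardinal is an initial ordinal: a well-order whose cardinality is
-- not that of any of its proper initial segments.

record Cardinal : Set₁ where
  field
    ∣_∣                : Set
    _<_                : Rel ∣_∣ 0ℓ
    isStrictTotalOrder : IsStrictTotalOrder _≡_ _<_
    wellFounded        : WellFounded _<_
    initial            : ∀ x → ¬ (∣_∣ ≼ El (_< x))

open Cardinal public using (∣_∣)

-- "The least cardinal with property Q is μ."  Invariants defined as a
-- least cardinal are given as relations of this form.  Two cardinals of
-- the same size need not be propositionally equal, so a cardinal is only
-- ever compared with others through injections and bijections.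

IsLeast : (Cardinal → Set ℓ) → Cardinal → Set (lsuc 0ℓ ⊔ ℓ)
IsLeast Q μ = Q μ × (∀ ν → Q ν → ∣ μ ∣ ≼ ∣ ν ∣)

Cofinal : (κ : Cardinal) → Pred ∣ κ ∣ 0ℓ → Set
Cofinal κ A = ∀ ξ → ∃[ η ] (η ∈ A × (ξ < η ⊎ ξ ≡ η))
  where open Cardinal κ using (_<_)

IsCofinality : Cardinal → Cardinal → Set₁
IsCofinality κ = IsLeast λ μ →
  ∃[ A ] (Cofinal κ A × (El A ⤖ ∣ μ ∣))

Regular : Cardinal → Set₁
Regular κ = (ℕ ≼ ∣ κ ∣) × IsCofinality κ κ

Uncountable : Cardinal → Set
Uncountable κ = ℕ ≺ ∣ κ ∣

-- Cardinals being ordinals, κ ≤ λ makes κ a subset of λ.  Between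
-- well-orders presented as types this inclusion is the embedding onto an
-- initial segment, which is unique, and exists (classically) when κ ≤ λ.

record InitialSegment (κ ƛ : Cardinal) : Set where
  open Cardinal κ using () renaming (_<_ to _<κ_)
  open Cardinal ƛ using () renaming (_<_ to _<ƛ_)
  field
    embed      : ∣ κ ∣ → ∣ ƛ ∣
    monotone   : ∀ {ξ η} → ξ <κ η → embed ξ <ƛ embed η
    downClosed : ∀ {α ξ} → α <ƛ embed ξ → ∃[ η ] (embed η ≡ α)

P[_] : Cardinal → Set → Set
P[ μ ] A = El {𝒫 A} (λ a → El ⟦ a ⟧ ≺ ∣ μ ∣)

record IsIdeal {S : Set} (K : Pred (𝒫 S) 0ℓ) : Set where
  field
    singleton : ∀ {s A} → ⟦ A ⟧ ≐ ｛ s ｝ → A ∈ K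
    subset    : ∀ {A B} → ⟦ A ⟧ ⊆ ⟦ B ⟧ → B ∈ K → A ∈ K
    union     : ∀ {A B C} → ⟦ A ⟧ ≐ ⟦ B ⟧ ∪ ⟦ C ⟧ → B ∈ K → C ∈ K → A ∈ K
    proper    : ∀ {A} → Universal ⟦ A ⟧ → A ∉ K

infix 8 _⁺

_⁺ : {S : Set} → Pred (𝒫 S) 0ℓ → Pred (𝒫 S) 0ℓ
K ⁺ = ∁ K

Complete : Cardinal → {S : Set} → Pred (𝒫 S) 0ℓ → Set₁
Complete κ {S} K = (x : Pred (𝒫 S) 0ℓ) → x ⊆ K → El x ≺ ∣ κ ∣ →
                   ∀ {A} → ⟦ A ⟧ ≐ ⋃₀ x → A ∈ K

IsCof : {S : Set} → Pred (𝒫 S) 0ℓ → Cardinal → Set₁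
IsCof K = IsLeast λ μ →
  ∃[ X ] (X ⊆ K × (El X ⤖ ∣ μ ∣) ×
          K ≐ (λ A → ∃[ B ] (B ∈ X × ⟦ A ⟧ ⊆ ⟦ B ⟧)))

-- The cofinality written with an overline, in which x ranges over P_κ(X)

IsCofBar : Cardinal → {S : Set} → Pred (𝒫 S) 0ℓ → Cardinal → Set₁
IsCofBar κ {S} K = IsLeast λ μ →
  ∃[ X ] (X ⊆ K × (El X ⤖ ∣ μ ∣) ×
          K ≐ (λ A → ∃ λ (x : Pred (𝒫 S) 0ℓ) →
                 x ⊆ X × El x ≺ ∣ κ ∣ × ⟦ A ⟧ ⊆ ⋃₀ x))

module _ (κ : Cardinal) where
  open Cardinal κ using (_<_)

  IdealOn : Pred (𝒫 ∣ κ ∣) 0ℓ → Set₁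
  IdealOn J = IsIdeal J × Complete κ J

  [_]² : 𝒫 ∣ κ ∣ → Pred (∣ κ ∣ × ∣ κ ∣) 0ℓ
  [ A ]² (ξ , η) = ξ ∈ ⟦ A ⟧ × η ∈ ⟦ A ⟧ × ξ < η

  -- J⁺ → [J⁺]²_ρ

  Square : Cardinal → Pred (𝒫 ∣ κ ∣) 0ℓ → Set
  Square ρ J =
    ∀ A → A ∈ J ⁺ → (f : El [ A ]² → ∣ ρ ∣) →
    ∃[ B ] (B ∈ J ⁺ × ⟦ B ⟧ ⊆ ⟦ A ⟧ × ¬ Universal (f ″ [ B ]²))

  -- As in the definition of non_κ(Q), which presupposes an ideal on κ
  -- failing Q, no τ is related to a Q that every ideal on κ satisfies.

  IsNon : (Pred (𝒫 ∣ κ ∣) 0ℓ → Set) → Cardinal → Set₁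
  IsNon Q = IsLeast λ τ → ∃[ J ] (IdealOn J × IsCof J τ × ¬ Q J)

  IsNonBar : (Pred (𝒫 ∣ κ ∣) 0ℓ → Set) → Cardinal → Set₁
  IsNonBar Q = IsLeast λ τ → ∃[ J ] (IdealOn J × IsCofBar κ J τ × ¬ Q J)

module _ (κ ƛ : Cardinal) where

  Pκ : Set
  Pκ = P[ κ ] ∣ ƛ ∣

  _⊑_ : Pκ → Pκ → Set
  a ⊑ b = ⟦ value a ⟧ ⊆ ⟦ value b ⟧

  I : Pred (𝒫 Pκ) 0ℓ
  I A = ∃[ a ] Empty (⟦ A ⟧ ∩ (a ⊑_))

  IdealOnPκ : Pred (𝒫 Pκ) 0ℓ → Set₁
  IdealOnPκ H = IsIdeal H × Complete κ H × I ⊆ H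

  𝒦 : Pred Cardinal (lsuc 0ℓ)
  𝒦 σ = ∣ ƛ ∣ ≼ ∣ σ ∣ ×
        ∃ λ (T : Pred Pκ 0ℓ) →
          (El T ⤖ ∣ σ ∣) × (∀ a → El (T ∩ (_⊑ a)) ≺ ∣ κ ∣)

module _ {κ ƛ : Cardinal} (κ⊆ƛ : InitialSegment κ ƛ) where
  open Cardinal κ using (_<_)
  open InitialSegment κ⊆ƛ using (embed)

  -- "ξ = ⋃(a ∩ κ)", by extensionality of the ordinal ξ = {η : η < ξ}

  _≡⋃[_∩κ] : ∣ κ ∣ → Pκ κ ƛ → Set
  ξ ≡⋃[ a ∩κ] =
    ∀ η → η < ξ ⇔ (∃[ ζ ] (embed ζ ∈ ⟦ value a ⟧ × η < ζ))

  [_]²κκ : Pred (Pκ κ ƛ) 0ℓ → Pred (∣ κ ∣ × ∣ κ ∣) 0ℓ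
  [ A ]²κκ (ξ , η) =
    ∃[ a ] ∃[ b ] (a ∈ A × b ∈ A × ξ ≡⋃[ a ∩κ] × η ≡⋃[ b ∩κ] × ξ < η)

  -- H⁺ → [H⁺]²_ρ, with κ above and below the arrow

  Squareκκ : Cardinal → Pred (𝒫 (Pκ κ ƛ)) 0ℓ → Set
  Squareκκ ρ H =
    (F : El [ U ]²κκ → ∣ ρ ∣) → ∀ A → A ∈ H ⁺ →
    ∃[ B ] (B ∈ H ⁺ × ⟦ B ⟧ ⊆ ⟦ A ⟧ × ¬ Universal (F ″ [ ⟦ B ⟧ ]²κκ))

{-# OPTIONS --safe #-}
module Submission where

-- Write sup a for ⋃(a ∩ κ), which is a member of κ since κ is regular.
--
-- (i) Given A ∈ H⁺, the sets Y ⊆ κ with A ∩ sup⁻¹ Y ∈ H form an ideal J on κ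
-- with cof(J) ≤ cof(H), which therefore satisfies the partition relation.
-- A colouring of pairs of suprema is a colouring on sup″A ∈ J⁺, and A ∩ sup⁻¹ Y
-- is as required when Y ⊆ sup″A is as required for J.
--
-- (ii) Suppose that J is an ideal on κ generated, up to unions of fewer than κ
-- members, by a family X with an injection h : X → T, where T ⊆ P_κ(λ) witnesses
-- σ ∈ 𝒦(κ,λ).  As λ > κ there is an injection s : λ → λ ∖ κ.  The sets
-- Gen(a) = ⋃ {B ∈ X : h B ⊆ s⁻¹ a} belong to J and are cofinal in it, and they do
-- not depend on a ∩ κ.  Hence {a : sup a ∈ A ∖ Gen(a)} is in I⁺ whenever A ∈ J⁺:
-- to a given a one adds a single ordinal of A ∖ Gen(a) above sup a.  If Z ∈ I⁺ is a
-- subset of that set, then sup″Z ∈ J⁺, because sup″Z ⊆ Gen(a) is refuted by any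
-- b ∈ Z containing a.  So J satisfies the partition relation.

open import Level using (0ℓ; Level)
open import Axiom.ExcludedMiddle using (ExcludedMiddle)
open import Axiom.Extensionality.Propositional
  using (Extensionality; implicit-extensionality)
open import Data.Bool.Base using (Bool; true; false)
open import Data.Empty using (⊥-elim)
open import Data.Fin.Base using (Fin) renaming (zero to fzero)
open import Data.Irrelevant using ([_])
open import Data.Maybe.Base using (Maybe; just; nothing)
open import Data.Maybe.Properties using (just-injective)
open import Data.Nat.Base using (ℕ; zero; suc; s≤s⁻¹) renaming (_<_ to _<ℕ_)
open import Data.Nat.Properties using (m≤n⇒m<n∨m≡n; <-cmp)
open import Data.Product.Base using (_×_; _,_; Σ; ∃; ∃-syntax; proj₁; proj₂)
open import Data.Refinement using (Refinement; value; refine; _,_)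
open import Data.Sum.Base as Sum using (_⊎_; inj₁; inj₂; fromInj₁; fromInj₂)
open import Data.Unit.Base using (tt)
open import Function.Base using (_∘_; id; _on_)
open import Function.Bundles
  using (_⤖_; mk↣; mk⤖; mk⇔; module Injection; module Bijection; module Equivalence)
open import Function.Construct.Composition using (_↣-∘_)
open import Function.Construct.Symmetry using (⤖-sym)
open import Function.Definitions using (Injective)
open import Induction.WellFounded using (WellFounded; module All; module FixPoint)
open import Relation.Binary.Construct.On using (wellFounded)
open import Relation.Binary.Core using (Rel)
open import Relation.Binary.Definitions using (Trichotomous; tri<; tri≈; tri>)
open import Relation.Binary.PropositionalEquality.Core
  using (_≡_; _≢_; refl; sym; trans; cong; subst)
open import Relation.Binary.PropositionalEquality.Properties using (isEquivalence)
open import Relation.Binary.Structures using (IsStrictTotalOrder)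
open import Relation.Binary.Structures.Biased using (isStrictTotalOrderᶜ)
open import Relation.Nullary.Decidable.Core
  using (Dec; yes; no; ⌊_⌋; toWitness; fromWitness; decidable-stable; recompute)
open import Relation.Nullary.Negation.Core using (¬_; contradiction)
open import Relation.Unary
  using (Pred; _∈_; _∉_; _⊆_; _≐_; _∪_; _∩_; U; ｛_｝; Empty)
open import Defs

private
  variable
    ℓ : Level
    A B C : Set

-- Injections, bijections and subsets as types.

⤖⇒≼ : A ⤖ B → A ≼ B
⤖⇒≼ b = Bijection.injection b

⤖⇒≽ : A ⤖ B → B ≼ A
⤖⇒≽ = ⤖⇒≼ ∘ ⤖-sym

El-≡ : {P : Pred A 0ℓ} {p q : El P} → value p ≡ value q → p ≡ q
El-≡ {p = _ , _} {q = _ , _} refl = refl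

El-mono : {P Q : Pred A 0ℓ} → P ⊆ Q → El P ≼ El Q
El-mono P⊆Q = mk↣ {to = refine P⊆Q} (El-≡ ∘ cong value)

El-value : {P : Pred A 0ℓ} → El P ≼ A
El-value = mk↣ {to = value} El-≡

El-compare : {P : Pred A 0ℓ} {_<_ : Rel A 0ℓ} → Trichotomous _≡_ _<_ →
             Trichotomous {A = El P} _≡_ (_<_ on value)
El-compare compare p q with compare (value p) (value q)
... | tri< p<q p≢q p≯q = tri< p<q (p≢q ∘ cong value) p≯q
... | tri≈ p≮q p≡q p≯q = tri≈ p≮q (El-≡ p≡q) p≯q
... | tri> p≮q p≢q p>q = tri> p≮q (p≢q ∘ cong value) p>q

-- Bernstein: on the points lying on a (g ∘ f)-orbit that starts outside
-- the range of g the bijection is f, elsewhere it is the inverse of g.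

data Orbit (f : A → B) (g : B → A) : Pred A 0ℓ where
  start : ∀ {a} → ¬ (∃[ b ] g b ≡ a) → Orbit f g a
  next  : ∀ {a} → Orbit f g a → Orbit f g (g (f a))

-- Classical tools: characteristic functions, choice and Bernstein's theorem.

module Classical (em : ∀ {ℓ} → ExcludedMiddle ℓ) (ext : Extensionality 0ℓ 0ℓ) where

  -- Existentials are Σ-types and Dec P carries an element of P, so excluded
  -- middle also serves as a choice principle throughout.

  byContradiction : {P : Set ℓ} → ¬ ¬ P → P
  byContradiction = decidable-stable em

  abstract
    char : Pred A 0ℓ → 𝒫 A
    char P a = ⌊ em {P = P a} ⌋

    char⁺ : {P : Pred A 0ℓ} → P ⊆ ⟦ char P ⟧
    char⁺ = fromWitness

    char⁻ : {P : Pred A 0ℓ} → ⟦ char P ⟧ ⊆ P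
    char⁻ = toWitness

  -- Erased membership proofs become usable here: excluded middle decides the proposition, and the
  -- decision stands in for the proof.
  member : {P : Pred A 0ℓ} (p : El P) → value p ∈ P
  member (_ , [ p ]) = recompute em p

  ≼-relate : (R : A → B → Set) → (∀ a → ∃ (R a)) →
             (∀ {a a′ b} → R a b → R a′ b → a ≡ a′) →
             A ≼ B
  ≼-relate R total unique = mk↣ {to = proj₁ ∘ total} λ {a} {a′} eq →
    unique (proj₂ (total a)) (subst (R a′) (sym eq) (proj₂ (total a′)))

  -- Used to bound images and preimages: `R a b` says that `b` is a code of `a`, and codes may be
  -- chosen freely as long as each determines what it codes.
  ≼-choose : {P : Pred A 0ℓ} (R : A → B → Set) →
             (∀ {a} → a ∈ P → ∃ (R a)) →
             (∀ {a a′ b} → R a b → R a′ b → a ≡ a′) →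
             El P ≼ B
  ≼-choose R choose unique =
    ≼-relate (R ∘ value) (choose ∘ member) (λ r r′ → El-≡ (unique r r′))

  bernstein : A ≼ B → B ≼ A → A ⤖ B
  bernstein {A} {B} A≼B B≼A = mk⤖ {to = h} (h-injective , h-surjective)
    where
    open Injection A≼B using () renaming (to to f; injective to f-injective)
    open Injection B≼A using () renaming (to to g; injective to g-injective)

    rangeOfG : ∀ {a} → ¬ Orbit f g a → ∃[ b ] g b ≡ a
    rangeOfG a∉ = byContradiction (a∉ ∘ start)

    h′ : ∀ a → Dec (Orbit f g a) → B
    h′ a (yes _)  = f a
    h′ a (no  a∉) = proj₁ (rangeOfG a∉)

    h : A → B
    h a = h′ a em

    h′-injective : ∀ {a a′} (d : Dec (Orbit f g a)) (d′ : Dec (Orbit f g a′)) →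
                   h′ a d ≡ h′ a′ d′ → a ≡ a′
    h′-injective (yes _) (yes _) eq = f-injective eq
    -- Were `a` on an orbit and `a′` not, equal values would make `a′` the point `g (f a)`, which
    -- continues the orbit of `a`.
    h′-injective (yes o) (no ¬o) eq = contradiction
      (subst (Orbit f g) (trans (cong g eq) (proj₂ (rangeOfG ¬o))) (next o)) ¬o
    h′-injective (no ¬o) (yes o) eq = contradiction
      (subst (Orbit f g) (trans (cong g (sym eq)) (proj₂ (rangeOfG ¬o))) (next o)) ¬o
    h′-injective (no ¬o) (no ¬o′) eq =
      trans (sym (proj₂ (rangeOfG ¬o))) (trans (cong g eq) (proj₂ (rangeOfG ¬o′)))

    h-injective : Injective _≡_ _≡_ h
    h-injective = h′-injective em em

    h-yes : ∀ {a} (d : Dec (Orbit f g a)) → Orbit f g a → h′ a d ≡ f a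
    h-yes (yes _) _ = refl
    h-yes (no ¬o) o = contradiction o ¬o

    h-no : ∀ {b} (d : Dec (Orbit f g (g b))) → ¬ Orbit f g (g b) → h′ (g b) d ≡ b
    h-no (yes o) ¬o = contradiction o ¬o
    h-no (no ¬o) _  = g-injective (proj₂ (rangeOfG ¬o))

    fromOrbit : ∀ {a b} → g b ≡ a → Orbit f g a → ∃[ a′ ] (Orbit f g a′ × f a′ ≡ b)
    fromOrbit gb≡a (start a∉) = contradiction (_ , gb≡a) a∉
    fromOrbit gb≡a (next o)   = _ , o , sym (g-injective gb≡a)

    h-surjective : ∀ b → ∃[ a ] (∀ {z} → z ≡ a → h z ≡ b)
    h-surjective b with em {P = Orbit f g (g b)}
    ... | no ¬o = g b , λ { refl → h-no em ¬o }
    ... | yes o with fromOrbit refl o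
    ...   | a , oa , fa≡b = a , λ { refl → trans (h-yes em oa) fa≡b }

  -- Well-founded recursion and comparison with well-orders.

  minimal : {_<_ : Rel A 0ℓ} → WellFounded _<_ → {P : Pred A ℓ} → ∃ P →
            ∃[ x ] (x ∈ P × ∀ {y} → y < x → y ∉ P)
  minimal {ℓ = ℓ} wf {P} (a , Pa) = byContradiction λ none →
    All.wfRec wf ℓ (_∉ P) (λ x below x∈P → none (x , x∈P , below)) a Pa

  abstract
    -- Recursion by specification: each step need only be solvable, and `total` chooses the
    -- solution. By extensionality a step cannot tell pointwise equal histories apart, which gives
    -- the unfolding equation.
    recursion : {_<_ : Rel A 0ℓ} → WellFounded _<_ →
                (Φ : (x : A) → (∀ {y} → y < x → C) → C → Set) →
                (∀ x (rec : ∀ {y} → y < x → C) → ∃ (Φ x rec)) →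
                Σ (A → C) λ f → ∀ x → Φ x (λ {y} _ → f y) (f x)
    recursion {A} {C} {_<_} wf Φ total = f , λ x →
      subst (Φ x _) (sym unfold-wfRec) (proj₂ (total x _))
      where
      step : ∀ x → (∀ {y} → y < x → C) → C
      step x rec = proj₁ (total x rec)

      open FixPoint wf (λ _ → C) step
        (λ x eq → cong {A = ∀ {y} → y < x → C} (λ rec → step x rec)
                       (implicit-extensionality ext (ext eq)))

      f : A → C
      f = All.wfRec wf 0ℓ (λ _ → C) step

  -- Map A into B by sending x to any point of B not yet taken; the first x
  -- at which this fails has all of B covered from below.

  comparable : {_<_ : Rel A 0ℓ} → Trichotomous _≡_ _<_ → WellFounded _<_ → ∀ B →
               A ≼ B ⊎ ∃[ x ] (B ⤖ El (_< x))
  comparable {A} {_<_} cmp wf B = result em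
    where
    -- The value `nothing` records that all of `B` is taken; a value `just b` must be new.
    Φ : (x : A) → (∀ {y} → y < x → Maybe B) → Maybe B → Set
    Φ x rec c =
      (∀ {y b} (y<x : y < x) → c ≡ just b → rec y<x ≢ just b) ×
      (c ≡ nothing → ∀ b → ∃[ y ] Σ (y < x) λ y<x → rec y<x ≡ just b)

    total : ∀ x (rec : ∀ {y} → y < x → Maybe B) → ∃ (Φ x rec)
    total x rec with em {P = ∃[ b ] (∀ {y} (y<x : y < x) → rec y<x ≢ just b)}
    ... | yes (b , fresh) = just b , (λ { y<x refl → fresh y<x }) , λ ()
    ... | no  covered     = nothing , (λ _ ()) , λ _ b → byContradiction λ none →
                              covered (b , λ y<x eq → none (_ , y<x , eq))

    rec : Σ (A → Maybe B) λ f → ∀ x → Φ x (λ {y} _ → f y) (f x)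
    rec = recursion wf Φ total

    f : A → Maybe B
    f = proj₁ rec

    fresh : ∀ {x y b} → y < x → f x ≡ just b → f y ≢ just b
    fresh = proj₁ (proj₂ rec _)

    f-injective : ∀ {x y b} → f x ≡ just b → f y ≡ just b → x ≡ y
    f-injective {x} {y} fx fy with cmp x y
    ... | tri< x<y _ _ = contradiction fx (fresh x<y fy)
    ... | tri≈ _ x≡y _ = x≡y
    ... | tri> _ _ y<x = contradiction fy (fresh y<x fx)

    just-of : ∀ {x} → f x ≢ nothing → ∃[ b ] f x ≡ just b
    just-of {x} fx≢ with f x
    ... | just b  = b , refl
    ... | nothing = contradiction refl fx≢

    result : Dec (∃[ x ] f x ≡ nothing) → A ≼ B ⊎ ∃[ x ] (B ⤖ El (_< x))
    result (no total) = inj₁ (mk↣ {to = λ x → proj₁ (value-at x)} λ {x} {y} eq →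
      f-injective (trans (proj₂ (value-at x)) (cong just eq)) (proj₂ (value-at y)))
      where
      value-at : ∀ x → ∃[ b ] f x ≡ just b
      value-at x = just-of λ fx → total (x , fx)
    result (yes some) with minimal wf some
    ... | x , fx , below = inj₂ (x , mk⤖ {to = to} (to-injective , to-surjective))
      where
      cover : ∀ b → ∃[ y ] Σ (y < x) λ _ → f y ≡ just b
      cover = proj₂ (proj₂ rec x) fx

      to : B → El (_< x)
      to b = proj₁ (cover b) , [ proj₁ (proj₂ (cover b)) ]

      to-injective : Injective _≡_ _≡_ to
      to-injective {b} {b′} eq =
        just-injective (trans (sym (proj₂ (proj₂ (cover b))))
                       (trans (cong (f ∘ value) eq) (proj₂ (proj₂ (cover b′)))))

      to-surjective : ∀ y → ∃[ b ] (∀ {b′} → b′ ≡ b → to b′ ≡ y)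
      to-surjective y with just-of (below (member y))
      ... | b , fy = b , λ { refl → El-≡ (f-injective (proj₂ (proj₂ (cover b))) fy) }

  -- Cardinals as ordinals: comparison, cardinalities and least cardinals.

  module Order (κ : Cardinal) where
    open Cardinal κ public using (_<_)
    open IsStrictTotalOrder (Cardinal.isStrictTotalOrder κ) public
      using (compare) renaming (trans to <-trans)

    <-irrefl : ∀ {ξ} → ¬ (ξ < ξ)
    <-irrefl = IsStrictTotalOrder.irrefl (Cardinal.isStrictTotalOrder κ) refl

    <⇒≢ : ∀ {ξ η} → ξ < η → ξ ≢ η
    <⇒≢ ξ<ξ refl = <-irrefl ξ<ξ

    ≮⇒≥ : ∀ {ξ η} → ¬ (η < ξ) → ξ < η ⊎ ξ ≡ η
    ≮⇒≥ {ξ} {η} η≮ξ with compare ξ η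
    ... | tri< ξ<η _ _ = inj₁ ξ<η
    ... | tri≈ _ ξ≡η _ = inj₂ ξ≡η
    ... | tri> _ _ η<ξ = contradiction η<ξ η≮ξ

    <-≤-trans : ∀ {ξ η ζ} → ξ < η → η < ζ ⊎ η ≡ ζ → ξ < ζ
    <-≤-trans ξ<η (inj₁ η<ζ)  = <-trans ξ<η η<ζ
    <-≤-trans ξ<η (inj₂ refl) = ξ<η

    comparableWith : ∀ B → ∣ κ ∣ ≼ B ⊎ ∃[ x ] (B ⤖ El (_< x))
    comparableWith = comparable compare (Cardinal.wellFounded κ)

    ≼⊎≽ : ∀ B → ∣ κ ∣ ≼ B ⊎ B ≼ ∣ κ ∣
    ≼⊎≽ B with comparableWith B
    ... | inj₁ κ≼B       = inj₁ κ≼B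
    ... | inj₂ (_ , B⤖x) = inj₂ (El-value ↣-∘ ⤖⇒≼ B⤖x)

    ⋠⇒≺ : ¬ (∣ κ ∣ ≼ B) → B ≺ ∣ κ ∣
    ⋠⇒≺ {B} κ⋠B = fromInj₂ (⊥-elim ∘ κ⋠B) (≼⊎≽ B) , κ⋠B

  -- If no proper segment of `μ` receives `A`, comparability embeds `μ` into `A` and Bernstein
  -- applies. Otherwise the least segment that does is an initial ordinal by minimality, and the
  -- same argument works for it.
  cardinality : ∀ μ → A ≼ ∣ μ ∣ → ∃[ τ ] (A ⤖ ∣ τ ∣)
  cardinality {A} μ A≼μ with em {P = ∃[ x ] (A ≼ El (_< x))}
    where open Cardinal μ using (_<_)
  ... | no none = μ ,
        bernstein A≼μ (fromInj₁ (λ (x , A⤖x) → ⊥-elim (none (x , ⤖⇒≼ A⤖x))) (Order.comparableWith μ A))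
  ... | yes some = τ ,
        bernstein A≼x (fromInj₁ (λ (y , A⤖y) → ⊥-elim (smaller y (⤖⇒≼ A⤖y)))
                                (Order.comparableWith τ A))
    where
    open Order μ
    least = minimal (Cardinal.wellFounded μ) some
    x = proj₁ least
    A≼x = proj₁ (proj₂ least)

    smaller : ∀ (y : El (_< x)) → ¬ (A ≼ El {El (_< x)} (λ z → value z < value y))
    smaller y A≼y = proj₂ (proj₂ least) (member y)
      (mk↣ {to = λ z → value (value z) , Refinement.proof z}
           (El-≡ ∘ El-≡ ∘ cong value) ↣-∘ A≼y)

    τ : Cardinal
    τ = record
      { ∣_∣ = El (_< x)
      ; _<_ = _<_ on value
      ; isStrictTotalOrder = isStrictTotalOrderᶜ (record
          { isEquivalence = isEquivalence ; trans = <-trans ; compare = El-compare compare })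
      ; wellFounded = wellFounded value (Cardinal.wellFounded μ)
      ; initial = λ y x≼y → smaller y (x≼y ↣-∘ A≼x)
      }

  -- The segments of `μ` serve as a well-ordered scale: take the least `x` whose segment receives
  -- some cardinal with `Q`. If no segment does, `μ` itself is least.
  leastCardinal : (Q : Cardinal → Set ℓ) → ∀ μ → Q μ → ∃ (IsLeast Q)
  leastCardinal Q μ Qμ with em {P = ∃[ x ] ∃[ ν ] (Q ν × ∣ ν ∣ ≼ El (_< x))}
    where open Cardinal μ using (_<_)
  ... | no none = μ , Qμ , λ ν Qν →
        fromInj₁ (λ (x , ν⤖x) → ⊥-elim (none (x , ν , Qν , ⤖⇒≼ ν⤖x)))
                 (Order.comparableWith μ ∣ ν ∣)
  ... | yes some with minimal (Cardinal.wellFounded μ) some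
  ...   | x , (ν , Qν , ν≼x) , below = ν , Qν , λ ν′ Qν′ → bound ν′ Qν′ (comparableWith ∣ ν′ ∣)
    where
    open Order μ
    bound : ∀ ν′ → Q ν′ → ∣ μ ∣ ≼ ∣ ν′ ∣ ⊎ ∃[ y ] (∣ ν′ ∣ ⤖ El (_< y)) → ∣ ν ∣ ≼ ∣ ν′ ∣
    bound ν′ Qν′ (inj₁ μ≼ν′) = μ≼ν′ ↣-∘ (El-value ↣-∘ ν≼x)
    bound ν′ Qν′ (inj₂ (y , ν′⤖y)) = ⤖⇒≽ ν′⤖y ↣-∘ (El-mono x≤y ↣-∘ ν≼x)
      where
      x≤y : (_< x) ⊆ (_< y)
      x≤y z<x = <-≤-trans z<x (≮⇒≥ λ y<x → below y<x (ν′ , Qν′ , ⤖⇒≼ ν′⤖y))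

  -- Sets of fewer than κ elements, for regular κ.

  module RegularCardinal (κ : Cardinal) (regular : Regular κ) where
    open Order κ

    -- By comparability this amounts to `A ≺ ∣ κ ∣`; the negative half passes to smaller sets by
    -- mere composition.
    Small : Set → Set
    Small A = ¬ (∣ κ ∣ ≼ A)

    ≼-Small : A ≼ B → Small B → Small A
    ≼-Small A≼B B-small κ≼A = B-small (A≼B ↣-∘ κ≼A)

    abstract
      -- An unbounded `g` has cofinal range, of cardinality at least `κ` by regularity; but the
      -- range injects into `A`.
      bounded : Small A → (g : A → ∣ κ ∣) → ∃[ ξ ] (∀ i → g i < ξ)
      bounded {A} A-small g = byContradiction λ unbounded →
        let range : Pred ∣ κ ∣ 0ℓ
            range ξ = ∃[ i ] g i ≡ ξ

            cofinal : Cofinal κ range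
            cofinal ξ = byContradiction λ none → unbounded (ξ , λ i → byContradiction λ gi≮ξ →
              none (g i , (i , refl) , ≮⇒≥ gi≮ξ))

            range≼A : El range ≼ A
            range≼A = ≼-choose (λ ξ i → g i ≡ ξ) id λ p q → trans (sym p) q

            τ , range⤖τ = cardinality κ (El-value {P = range})
        in A-small (range≼A ↣-∘ (⤖⇒≽ range⤖τ ↣-∘
                    proj₂ (proj₂ regular) τ (range , cofinal , range⤖τ)))

    -- If κ embeds into the union, then the fibres of a function κ → I have
    -- strict upper bounds β i, and a bound on β is in no fibre.

    ⋃-Small : {I : Set} (P : I → Pred B 0ℓ) → Small I → (∀ i → Small (El (P i))) →
              Small (El (λ b → ∃[ i ] b ∈ P i))
    ⋃-Small {I = I} P I-small P-small κ≼⋃ =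
      <-irrefl (<-trans (proj₂ β<γ _) (proj₂ (β _) (γ , [ refl ])))
      where
      open Injection κ≼⋃ using (to; injective)

      index : ∣ κ ∣ → I
      index ξ = proj₁ (member (to ξ))

      Fibre : I → Set
      Fibre i = El (λ ξ → index ξ ≡ i)

      fibre≼P : ∀ i → Fibre i ≼ El (P i)
      fibre≼P i = ≼-choose (λ ξ p → value (to ξ) ≡ value p)
        (λ {ξ} → λ { refl → (value (to ξ) , [ proj₂ (member (to ξ)) ]) , refl })
        (λ p q → injective (El-≡ (trans p (sym q))))

      β : ∀ i → ∃[ ξ ] (∀ (p : Fibre i) → value p < ξ)
      β i = bounded (≼-Small (fibre≼P i) (P-small i)) value

      β<γ : ∃[ γ ] (∀ i → proj₁ (β i) < γ)
      β<γ = bounded I-small (proj₁ ∘ β)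

      γ = proj₁ β<γ

    segment-Small : ∀ ξ → Small (El (_< ξ))
    segment-Small = Cardinal.initial κ

    -- Serves singletons, which embed into `Bool`, and binary unions, which are unions indexed by
    -- `Bool`.
    Bool-Small : Small Bool
    Bool-Small κ≼Bool =
      pigeonhole (to 0) (to 1) (to 2) (0≢1 ∘ injective) (0≢2 ∘ injective) (1≢2 ∘ injective)
      where
      open Injection (κ≼Bool ↣-∘ proj₁ regular) using (to; injective)
      0≢1 : 0 ≢ 1
      0≢1 ()
      0≢2 : 0 ≢ 2
      0≢2 ()
      1≢2 : 1 ≢ 2
      1≢2 ()
      pigeonhole : ∀ x y z → x ≢ y → x ≢ z → ¬ (y ≢ z)
      pigeonhole false false _     x≢y _ _ = x≢y refl
      pigeonhole false true  false _ x≢z _ = x≢z refl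
      pigeonhole false true  true  _ _ y≢z = y≢z refl
      pigeonhole true  true  _     x≢y _ _ = x≢y refl
      pigeonhole true  false true  _ x≢z _ = x≢z refl
      pigeonhole true  false false _ _ y≢z = y≢z refl

    singleton-Small : ∀ (a : A) → Small (El ｛ a ｝)
    singleton-Small a = ≼-Small (mk↣ {to = λ _ → true} λ {p} {q} _ →
      El-≡ (trans (sym (member p)) (member q))) Bool-Small

    ∪-Small : {P Q : Pred A 0ℓ} → Small (El P) → Small (El Q) → Small (El (P ∪ Q))
    ∪-Small {P = P} {Q} P-small Q-small = ≼-Small
      (El-mono λ { (inj₁ p) → true , p ; (inj₂ q) → false , q })
      (⋃-Small (λ { true → P ; false → Q }) Bool-Small λ { true → P-small ; false → Q-small })

    above : ∀ ξ → ∃[ η ] ξ < η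
    above ξ with bounded (singleton-Small ξ) value
    ... | η , <η = η , <η (ξ , [ refl ])

  -- An injection of λ into λ minus κ.

  -- The points of κ arranged as ω·α + n, with n counted by iterating a
  -- function S above the identity.

  κ×ℕ≼κ : ∀ κ → Regular κ → Uncountable κ → (∣ κ ∣ × ℕ) ≼ ∣ κ ∣
  κ×ℕ≼κ κ regular uncountable = mk↣ {to = λ (α , n) → S^ n (m α)} injective
    where
    open Order κ
    open RegularCardinal κ regular

    S : ∣ κ ∣ → ∣ κ ∣
    S = proj₁ ∘ above

    S^ : ℕ → ∣ κ ∣ → ∣ κ ∣
    S^ zero    ξ = ξ
    S^ (suc n) ξ = S (S^ n ξ)

    S^-mono : ∀ ξ {n k} → n <ℕ k → S^ n ξ < S^ k ξ
    S^-mono ξ {n} {suc k} n<1+k with m≤n⇒m<n∨m≡n (s≤s⁻¹ n<1+k)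
    ... | inj₁ n<k  = <-trans (S^-mono ξ n<k) (proj₂ (above _))
    ... | inj₂ refl = proj₂ (above _)

    -- Uncountability enters here: it says that `ℕ` is `Small`.
    limit : ∀ ξ → ∃[ η ] (∀ n → S^ n ξ < η)
    limit ξ = bounded (proj₂ uncountable) λ n → S^ n ξ

    -- `m α` stands for ω·α, but is only required to exceed the limits of all earlier blocks, which
    -- keeps the blocks disjoint.
    multiples : Σ (∣ κ ∣ → ∣ κ ∣) λ m → ∀ α (p : El (_< α)) → proj₁ (limit (m (value p))) < m α
    multiples = recursion (Cardinal.wellFounded κ)
      (λ α rec γ → ∀ (p : El (_< α)) → proj₁ (limit (rec (member p))) < γ)
      λ α rec → bounded (segment-Small α) λ p → proj₁ (limit (rec (member p)))

    m : ∣ κ ∣ → ∣ κ ∣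
    m = proj₁ multiples

    m-limit : ∀ {α β} → β < α → ∀ n k → S^ n (m β) < S^ k (m α)
    m-limit {α} {β} β<α n zero    =
      <-trans (proj₂ (limit (m β)) n) (proj₂ multiples α (β , [ β<α ]))
    m-limit {α} {β} β<α n (suc k) = <-trans (m-limit β<α n k) (proj₂ (above (S^ k (m α))))

    injective : Injective _≡_ _≡_ λ ((α , n) : ∣ κ ∣ × ℕ) → S^ n (m α)
    injective {α , n} {β , k} eq with compare α β | <-cmp n k
    ... | tri< α<β _ _  | _ = contradiction eq (<⇒≢ (m-limit α<β n k))
    ... | tri> _ _ β<α  | _ = contradiction (sym eq) (<⇒≢ (m-limit β<α k n))
    ... | tri≈ _ refl _ | tri< n<k _ _ = contradiction eq (<⇒≢ (S^-mono (m α) n<k))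
    ... | tri≈ _ refl _ | tri≈ _ refl _ = refl
    ... | tri≈ _ refl _ | tri> _ _ k<n = contradiction (sym eq) (<⇒≢ (S^-mono (m α) k<n))

  -- Hilbert's hotel on a copy of κ × ℕ in ƛ whose column 0 is the given
  -- copy of κ; if there were no such copy, ƛ would embed into κ × ℕ.

  shift : ∀ {κ ƛ} → Regular κ → Uncountable κ → ∣ κ ∣ ≺ ∣ ƛ ∣ →
          (e : ∣ κ ∣ ≼ ∣ ƛ ∣) → let open Injection e renaming (to to embed) in
          Σ (∣ ƛ ∣ ≼ ∣ ƛ ∣) λ s → ∀ α ξ → Injection.to s α ≢ embed ξ
  shift {κ} {ƛ} regular uncountable κ≺ƛ e = hotel (column
    (comparable (El-compare compare) (wellFounded value (Cardinal.wellFounded ƛ)) (∣ κ ∣ × ℕ)))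
    where
    open Order ƛ
    open Injection e using () renaming (to to embed; injective to embed-injective)

    Rest : Set
    Rest = El (λ α → ¬ (∃[ ξ ] embed ξ ≡ α))

    right : ∣ κ ∣ × ℕ → ∣ κ ∣ × ℕ
    right (ξ , n) = ξ , suc n

    right-injective : ∀ {p q} → right p ≡ right q → p ≡ q
    right-injective refl = refl

    ƛ≼κ×ℕ : Rest ≼ (∣ κ ∣ × ℕ) → ∣ ƛ ∣ ≼ (∣ κ ∣ × ℕ)
    ƛ≼κ×ℕ r = ≼-relate Place total unique
      where
      open Injection r using (to; injective)

      -- Column 0 is reserved for `κ`, so the rest is moved one column to the right.
      Place : ∣ ƛ ∣ → ∣ κ ∣ × ℕ → Set
      Place α p =
        (∃[ ξ ] (embed ξ ≡ α × (ξ , 0) ≡ p)) ⊎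
        (∃[ β ] (value β ≡ α × right (to β) ≡ p))

      total : ∀ α → ∃ (Place α)
      total α with em {P = ∃[ ξ ] embed ξ ≡ α}
      ... | yes (ξ , eq) = _ , inj₁ (ξ , eq , refl)
      ... | no α∉        = _ , inj₂ ((α , [ α∉ ]) , refl , refl)

      unique : ∀ {α α′ p} → Place α p → Place α′ p → α ≡ α′
      unique (inj₁ (_ , refl , refl)) (inj₁ (_ , refl , refl)) = refl
      unique (inj₁ (_ , refl , refl)) (inj₂ (_ , refl , ()))
      unique (inj₂ (_ , refl , refl)) (inj₁ (_ , refl , ()))
      unique (inj₂ (_ , refl , refl)) (inj₂ (_ , refl , eq)) =
        cong value (injective (right-injective (sym eq)))

    column : Rest ≼ (∣ κ ∣ × ℕ) ⊎ ∃[ x ] ((∣ κ ∣ × ℕ) ⤖ _) → (∣ κ ∣ × ℕ) ≼ Rest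
    column (inj₁ r) = contradiction (κ×ℕ≼κ κ regular uncountable ↣-∘ ƛ≼κ×ℕ r) (proj₂ κ≺ƛ)
    column (inj₂ (x , κ×ℕ⤖x)) = El-value ↣-∘ ⤖⇒≼ κ×ℕ⤖x

    hotel : (∣ κ ∣ × ℕ) ≼ Rest → Σ (∣ ƛ ∣ ≼ ∣ ƛ ∣) λ s → ∀ α ξ → Injection.to s α ≢ embed ξ
    hotel k = ≼-relate Move total unique , λ α ξ → avoids (proj₂ (total α))
      where
      room : ∣ κ ∣ × ℕ → ∣ ƛ ∣
      room (ξ , zero)  = embed ξ
      room (ξ , suc n) = value (Injection.to k (ξ , n))

      room-injective : ∀ p q → room p ≡ room q → p ≡ q
      room-injective (ξ , zero)  (η , zero)  eq = cong (_, 0) (embed-injective eq)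
      room-injective (ξ , zero)  (η , suc m) eq =
        contradiction (ξ , eq) (member (Injection.to k _))
      room-injective (ξ , suc n) (η , zero)  eq =
        contradiction (η , sym eq) (member (Injection.to k _))
      room-injective (ξ , suc n) (η , suc m) eq = cong right (Injection.injective k (El-≡ eq))

      Move : ∣ ƛ ∣ → ∣ ƛ ∣ → Set
      Move α β = (∃[ p ] (room p ≡ α × room (right p) ≡ β)) ⊎ ((∀ p → room p ≢ α) × α ≡ β)

      total : ∀ α → ∃ (Move α)
      total α with em {P = ∃[ p ] room p ≡ α}
      ... | yes (p , eq) = _ , inj₁ (p , eq , refl)
      ... | no none      = α , inj₂ ((λ p eq → none (p , eq)) , refl)

      unique : ∀ {α α′ β} → Move α β → Move α′ β → α ≡ α′
      unique (inj₁ (p , refl , refl)) (inj₁ (q , refl , eq)) =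
        cong room (right-injective (room-injective (right p) (right q) (sym eq)))
      unique (inj₁ (p , refl , refl)) (inj₂ (none , eq))   = contradiction (sym eq) (none (right p))
      unique (inj₂ (none , eq)) (inj₁ (p , refl , refl))   = contradiction (sym eq) (none (right p))
      unique (inj₂ (_ , refl)) (inj₂ (_ , refl))           = refl

      -- A moved point lands in a positive column, and a point that stays lies in no column at all.
      avoids : ∀ {α β ξ} → Move α β → β ≢ embed ξ
      avoids {ξ = ξ} (inj₁ (p , _ , refl)) eq with () ← room-injective (right p) (ξ , 0) eq
      avoids {ξ = ξ} (inj₂ (none , refl)) eq  = none (ξ , 0) (sym eq)

  -- Cofinality of an ideal, and suprema of traces on κ.

  -- The cardinality of a given base is where `leastCardinal` starts its search, so it also bounds
  -- the result.
  cof-exists : {S : Set} {K X : Pred (𝒫 S) 0ℓ} → IsIdeal K → X ⊆ K →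
               (∀ {A} → A ∈ K → ∃[ B ] (B ∈ X × ⟦ A ⟧ ⊆ ⟦ B ⟧)) →
               ∀ μ → El X ≼ ∣ μ ∣ → ∃[ τ ] (IsCof K τ × ∣ τ ∣ ≼ ∣ μ ∣)
  cof-exists {K = K} {X} K-ideal X⊆K covers μ X≼μ =
    let ν , X⤖ν     = cardinality μ X≼μ
        basis       = X , X⊆K , X⤖ν , covers ,
                      λ (_ , B∈X , A⊆B) → IsIdeal.subset K-ideal A⊆B (X⊆K B∈X)
        τ , τ-least = leastCardinal _ ν basis
    in τ , τ-least , X≼μ ↣-∘ (⤖⇒≽ X⤖ν ↣-∘ proj₂ τ-least ν basis)

  module Supremum {κ ƛ : Cardinal} (regular : Regular κ) (κ⊆ƛ : InitialSegment κ ƛ) where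
    open Order κ
    open RegularCardinal κ regular
    open InitialSegment κ⊆ƛ

    embedding : ∣ κ ∣ ≼ ∣ ƛ ∣
    embedding = mk↣ {to = embed} embed-injective
      where
      embed-injective : Injective _≡_ _≡_ embed
      embed-injective {ξ} {η} eq with compare ξ η
      ... | tri< ξ<η _ _ = contradiction eq (Order.<⇒≢ ƛ (monotone ξ<η))
      ... | tri≈ _ ξ≡η _ = ξ≡η
      ... | tri> _ _ η<ξ = contradiction (sym eq) (Order.<⇒≢ ƛ (monotone η<ξ))

    open Injection embedding public using () renaming (injective to embed-injective)

    Pκ-Small : (a : Pκ κ ƛ) → Small (El ⟦ value a ⟧)
    Pκ-Small a = proj₂ (member a)

    mkPκ : (P : Pred ∣ ƛ ∣ 0ℓ) → Small (El P) → Pκ κ ƛ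
    mkPκ P P-small = char P , [ ⋠⇒≺ (≼-Small (El-mono char⁻) P-small) ]

    IsSup : ∣ κ ∣ → Pκ κ ƛ → Set
    IsSup = _≡⋃[_∩κ] κ⊆ƛ

    IsSup-unique : ∀ {ξ η} a → IsSup ξ a → IsSup η a → ξ ≡ η
    IsSup-unique {ξ} {η} _ ξ-sup η-sup with compare ξ η
    ... | tri< ξ<η _ _ = contradiction (from (ξ-sup ξ) (to (η-sup ξ) ξ<η)) <-irrefl
      where open Equivalence using (to; from)
    ... | tri≈ _ ξ≡η _ = ξ≡η
    ... | tri> _ _ η<ξ = contradiction (from (η-sup η) (to (ξ-sup η) η<ξ)) <-irrefl
      where open Equivalence using (to; from)

    abstract
      -- Regularity bounds the trace of `a` on `κ`. Its least weak upper bound is the union, since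
      -- any smaller `η` is exceeded by a point of the trace. The bound is weak because a greatest
      -- element of the trace is its union.
      sup-exists : ∀ a → ∃[ ξ ] IsSup ξ a
      sup-exists a with bounded trace-Small value
        where
        trace-Small : Small (El (λ ξ → embed ξ ∈ ⟦ value a ⟧))
        trace-Small = ≼-Small
          (≼-choose (λ ξ p → embed ξ ≡ value p) (λ p → (_ , [ p ]) , refl)
                    (λ eq eq′ → embed-injective (trans eq (sym eq′))))
          (Pκ-Small a)
      ... | β , <β with minimal (Cardinal.wellFounded κ)
                          {P = λ ξ → ∀ {ζ} → embed ζ ∈ ⟦ value a ⟧ → ζ < ξ ⊎ ζ ≡ ξ}
                          (β , λ p → inj₁ (<β (_ , [ p ])))
      ...   | ξ , ≤ξ , below = ξ , λ η → mk⇔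
        (λ η<ξ → byContradiction λ none → below η<ξ λ ζ∈a → ≮⇒≥ λ η<ζ → none (_ , ζ∈a , η<ζ))
        (λ (ζ , ζ∈a , η<ζ) → <-≤-trans η<ζ (≤ξ ζ∈a))

      sup : Pκ κ ƛ → ∣ κ ∣
      sup a = proj₁ (sup-exists a)

      sup-isSup : ∀ a → IsSup (sup a) a
      sup-isSup a = proj₂ (sup-exists a)

    <sup : ∀ {a ζ ξ} → embed ζ ∈ ⟦ value a ⟧ → ξ < ζ → ξ < sup a
    <sup {a} ζ∈a ξ<ζ = Equivalence.from (sup-isSup a _) (_ , ζ∈a , ξ<ζ)

    -- A set containing a point of `κ` above `ξ` has supremum greater than `ξ`.
    sup-fibre∈I : ∀ ξ → char (λ a → sup a ≡ ξ) ∈ I κ ƛ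
    sup-fibre∈I ξ = mkPκ ｛ embed (proj₁ (above ξ)) ｝ (singleton-Small _) ,
      λ b (sup≡ξ , ⊆b) → <⇒≢ (<sup (⊆b (char⁺ refl)) (proj₂ (above ξ))) (sym (char⁻ sup≡ξ))

    -- Part (i): projecting an ideal to κ.

    module Projection {H : Pred (𝒫 (Pκ κ ƛ)) 0ℓ} (H-ideal : IdealOnPκ κ ƛ H)
                      {A : 𝒫 (Pκ κ ƛ)} (A∈H⁺ : A ∈ H ⁺) where
      open IsIdeal (proj₁ H-ideal)

      preimage : 𝒫 ∣ κ ∣ → 𝒫 (Pκ κ ƛ)
      preimage Y = char λ a → a ∈ ⟦ A ⟧ × sup a ∈ ⟦ Y ⟧

      -- The image under `sup` of the restriction of `H` to `A`. Fineness of `H` provides its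
      -- singletons.
      J : Pred (𝒫 ∣ κ ∣) 0ℓ
      J Y = preimage Y ∈ H

      J-ideal : IdealOn κ J
      J-ideal = record
        { singleton = λ Y≐ξ → subset (λ a∈ → char⁺ (sym (proj₁ Y≐ξ (proj₂ (char⁻ a∈)))))
                                     (proj₂ (proj₂ H-ideal) (sup-fibre∈I _))
        ; subset = λ Y⊆Z → subset λ a∈ → let a∈A , ∈Y = char⁻ a∈ in char⁺ (a∈A , Y⊆Z ∈Y)
        ; union = λ X≐Y∪Z → union
            ( (λ a∈ → let a∈A , ∈X = char⁻ a∈ in
                 Sum.map (λ ∈Y → char⁺ (a∈A , ∈Y)) (λ ∈Z → char⁺ (a∈A , ∈Z)) (proj₁ X≐Y∪Z ∈X))
            , λ { (inj₁ a∈) → let a∈A , ∈Y = char⁻ a∈ in char⁺ (a∈A , proj₂ X≐Y∪Z (inj₁ ∈Y))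
                ; (inj₂ a∈) → let a∈A , ∈Z = char⁻ a∈ in char⁺ (a∈A , proj₂ X≐Y∪Z (inj₂ ∈Z)) })
        ; proper = λ all J∋Y → A∈H⁺ (subset (λ a∈A → char⁺ (a∈A , all _)) J∋Y)
        } , complete
        where
        complete : Complete κ J
        complete x x⊆J x-small {Y} Y≐⋃x = proj₁ (proj₂ H-ideal)
          (λ Z → ∃[ B ] (B ∈ x × preimage B ≡ Z))
          (λ { (B , B∈x , refl) → x⊆J B∈x })
          (⋠⇒≺ (≼-Small (≼-choose (λ Z B → preimage (value B) ≡ Z)
                                  (λ (B , B∈x , eq) → (B , [ B∈x ]) , eq)
                                  (λ eq eq′ → trans (sym eq) eq′))
                        (proj₂ x-small)))
          {preimage Y}
          ( (λ a∈ → let a∈A , ∈Y = char⁻ a∈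
                        B , B∈x , ∈B = proj₁ Y≐⋃x ∈Y
                    in preimage B , (B , B∈x , refl) , char⁺ (a∈A , ∈B))
          , λ { (_ , (B , B∈x , refl) , a∈) → let a∈A , ∈B = char⁻ a∈
                                              in char⁺ (a∈A , proj₂ Y≐⋃x (B , B∈x , ∈B)) })

      -- The largest `Y` with `preimage Y` inside `B`; hence the cores of a base of `H` form a base
      -- of `J`.
      core : 𝒫 (Pκ κ ƛ) → 𝒫 ∣ κ ∣
      core B = char λ ξ → ∀ {a} → a ∈ ⟦ A ⟧ → sup a ≡ ξ → a ∈ ⟦ B ⟧

      J-cof : ∀ {μ} → IsCof H μ → ∃[ τ ] (IsCof J τ × ∣ τ ∣ ≼ ∣ μ ∣)
      J-cof {μ} ((X , X⊆H , X⤖μ , H⊆ , _) , _) = cof-exists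
        {X = λ Y → ∃[ B ] (B ∈ X × core B ≡ Y)}
        (proj₁ J-ideal)
        (λ { (B , B∈X , refl) →
             subset {preimage (core B)} (λ a∈ → let a∈A , ∈core = char⁻ a∈ in char⁻ ∈core a∈A refl)
                    (X⊆H B∈X) })
        (λ Y∈J → let B , B∈X , ⊆B = H⊆ Y∈J in
             core B , (B , B∈X , refl) , λ ξ∈Y → char⁺ λ { a∈A refl → ⊆B (char⁺ (a∈A , ξ∈Y)) })
        μ (⤖⇒≼ X⤖μ ↣-∘ ≼-choose (λ Y B → core (value B) ≡ Y)
             (λ (B , B∈X , eq) → (B , [ B∈X ]) , eq) (λ eq eq′ → trans (sym eq) eq′))

      sups : 𝒫 ∣ κ ∣
      sups = char λ ξ → ∃[ a ] (a ∈ ⟦ A ⟧ × sup a ≡ ξ)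

      sups∈J⁺ : sups ∈ J ⁺
      sups∈J⁺ sups∈J = A∈H⁺ (subset (λ a∈A → char⁺ (a∈A , char⁺ (_ , a∈A , refl))) sups∈J)

    partition-below-non : ∀ {ρ H} μ ν → IdealOnPκ κ ƛ H → IsCof H μ → IsNon κ (Square κ ρ) ν →
                          ∣ μ ∣ ≺ ∣ ν ∣ → Squareκκ κ⊆ƛ ρ H
    partition-below-non {ρ} {H} μ ν H-ideal μ-cof ν-non μ≺ν F A A∈H⁺ =
      preimage Y , Y∈J⁺ , (λ {_} → proj₁ ∘ char⁻) ,
      λ universal → F-omits λ c → colour (universal c)
      where
      open Projection H-ideal A∈H⁺

      -- If `J` failed, leastness of `ν` would give `ν ≼ τ ≼ μ`.
      J-square : Square κ ρ J
      J-square = byContradiction λ ¬square →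
        let τ , τ-cof , τ≼μ = J-cof {μ} μ-cof
        in proj₂ μ≺ν (τ≼μ ↣-∘ proj₂ ν-non τ (J , J-ideal , τ-cof , ¬square))

      lift : [_]² κ sups ⊆ [_]²κκ κ⊆ƛ U
      lift (ξ∈ , η∈ , ξ<η) with char⁻ ξ∈ | char⁻ η∈
      ... | a , _ , refl | b , _ , refl = a , b , tt , tt , sup-isSup a , sup-isSup b , ξ<η

      f : El ([_]² κ sups) → ∣ ρ ∣
      f = F ∘ refine lift

      Y = proj₁ (J-square sups sups∈J⁺ f)
      Y∈J⁺ = proj₁ (proj₂ (J-square sups sups∈J⁺ f))
      Y⊆sups = proj₁ (proj₂ (proj₂ (J-square sups sups∈J⁺ f)))
      F-omits = proj₂ (proj₂ (proj₂ (J-square sups sups∈J⁺ f)))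

      -- Suprema are unique, so a pair arising from `preimage Y` is a pair from `Y`; erased proofs
      -- do not affect its colour. A colour omitted by `f` is thus omitted by `F`.
      colour : ∀ {c} → (F ″ [_]²κκ κ⊆ƛ ⟦ preimage Y ⟧) c → (f ″ [_]² κ Y) c
      colour (p , (a , b , a∈ , b∈ , ξ-sup , η-sup , ξ<η) , Fp≡c) =
        (value p , [ Y⊆sups ξ∈Y , Y⊆sups η∈Y , ξ<η ]) , (ξ∈Y , η∈Y , ξ<η) , Fp≡c
        where
        ξ∈Y = subst (_∈ ⟦ Y ⟧) (IsSup-unique a (sup-isSup a) ξ-sup) (proj₂ (char⁻ a∈))
        η∈Y = subst (_∈ ⟦ Y ⟧) (IsSup-unique b (sup-isSup b) η-sup) (proj₂ (char⁻ b∈))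

    -- Part (ii): coding a generating family by a sparse family.

    initial∈J : ∀ {J} → IdealOn κ J → ∀ ξ → char (_< ξ) ∈ J
    initial∈J (J-ideal , complete) ξ = complete (λ Y → ∃[ η ] (η < ξ × char ｛ η ｝ ≡ Y))
      (λ { (η , _ , refl) → IsIdeal.singleton J-ideal (char⁻ , char⁺) })
      (⋠⇒≺ (≼-Small (≼-choose (λ Y (p : El (_< ξ)) → char ｛ value p ｝ ≡ Y)
                              (λ (η , η<ξ , eq) → (η , [ η<ξ ]) , eq)
                              (λ eq eq′ → trans (sym eq) eq′))
                    (segment-Small ξ)))
      ( (λ η∈ → _ , (_ , char⁻ η∈ , refl) , char⁺ refl)
      , λ { (_ , (η , η<ξ , refl) , ∈η) → char⁺ (subst (_< ξ) (char⁻ ∈η) η<ξ) })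

    module Coding (s : ∣ ƛ ∣ ≼ ∣ ƛ ∣) (s-avoids : ∀ α ξ → Injection.to s α ≢ embed ξ)
                  {T : Pred (Pκ κ ƛ) 0ℓ} (T-sparse : ∀ a → Small (El (T ∩ λ t → _⊑_ κ ƛ t a)))
                  {J : Pred (𝒫 ∣ κ ∣) 0ℓ} (J-ideal : IdealOn κ J)
                  {X : Pred (𝒫 ∣ κ ∣) 0ℓ} (X⊆J : X ⊆ J) (h : El X ≼ El T)
                  (generates : ∀ {Y} → Y ∈ J → ∃ λ (x : Pred (𝒫 ∣ κ ∣) 0ℓ) →
                               x ⊆ X × El x ≺ ∣ κ ∣ × ⟦ Y ⟧ ⊆ ⋃₀ x)
                  where
      open Injection s using () renaming (to to s⟨_⟩; injective to s-injective)
      open Injection h using () renaming (to to h⟨_⟩; injective to h-injective)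

      pull : Pκ κ ƛ → Pκ κ ƛ
      pull a = mkPκ (λ α → s⟨ α ⟩ ∈ ⟦ value a ⟧) (≼-Small
        (≼-choose (λ α p → s⟨ α ⟩ ≡ value p) (λ p → (_ , [ p ]) , refl)
                  (λ eq eq′ → s-injective (trans eq (sym eq′))))
        (Pκ-Small a))

      Coded : Pκ κ ƛ → Pred (𝒫 ∣ κ ∣) 0ℓ
      Coded a B = ∃[ p ] (value p ≡ B × _⊑_ κ ƛ (value h⟨ p ⟩) (pull a))

      Gen : Pκ κ ƛ → 𝒫 ∣ κ ∣
      Gen a = char (⋃₀ (Coded a))

      -- Sparseness leaves fewer than `κ` members of `T` inside `pull a`, and `h` is injective, so
      -- fewer than `κ` sets are united.
      Gen∈J : ∀ a → Gen a ∈ J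
      Gen∈J a = proj₂ J-ideal (Coded a) (λ { (p , refl , _) → X⊆J (member p) })
        (⋠⇒≺ (≼-Small
          (≼-choose (λ B t → ∃[ p ] (value p ≡ B × value h⟨ p ⟩ ≡ value t))
                    (λ (p , eq , ⊑a) → (value h⟨ p ⟩ , [ member h⟨ p ⟩ , ⊑a ]) , p , eq , refl)
                    (λ { (p , refl , eq) (q , refl , eq′) →
                         cong value (h-injective (El-≡ (trans eq (sym eq′)))) }))
          (T-sparse a′)))
        (char⁻ , char⁺)
        where a′ = pull a

      -- Membership in `Coded` only tests points `s⟨ α ⟩`, all of which lie outside the copy of `κ`.
      Gen-mono : ∀ a b → (∀ {α} → (∀ ξ → α ≢ embed ξ) → α ∈ ⟦ value a ⟧ → α ∈ ⟦ value b ⟧) →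
               ⟦ Gen a ⟧ ⊆ ⟦ Gen b ⟧
      Gen-mono a b a⊆b ξ∈ with char⁻ ξ∈
      ... | B , (p , eq , ⊑a) , ξ∈B =
        char⁺ (B , (p , eq , λ α∈ → char⁺ (a⊆b (s-avoids _) (char⁻ (⊑a α∈)))) , ξ∈B)

      -- The witness is the union of the `s`-images of the codes of the sets covering `Y`; by
      -- regularity it is again `Small`.
      Gen-cofinal : ∀ {Y} → Y ∈ J → ∃[ a ] ⟦ Y ⟧ ⊆ ⟦ Gen a ⟧
      Gen-cofinal {Y} Y∈J with generates Y∈J
      ... | x , x⊆X , x-small , Y⊆⋃x = a , Y⊆Gen
        where
        code : El x → Pκ κ ƛ
        code B = value h⟨ refine x⊆X B ⟩

        Image : El x → Pred ∣ ƛ ∣ 0ℓ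
        Image B β = ∃[ α ] (α ∈ ⟦ value (code B) ⟧ × s⟨ α ⟩ ≡ β)

        a : Pκ κ ƛ
        a = mkPκ (λ β → ∃[ B ] β ∈ Image B) (⋃-Small Image (proj₂ x-small) λ B → ≼-Small
          (≼-choose (λ β p → s⟨ value p ⟩ ≡ β) (λ (α , α∈ , eq) → (α , [ α∈ ]) , eq)
                    (λ eq eq′ → trans (sym eq) eq′))
          (Pκ-Small (code B)))

        Y⊆Gen : ⟦ Y ⟧ ⊆ ⟦ Gen a ⟧
        Y⊆Gen ξ∈Y with Y⊆⋃x ξ∈Y
        ... | B , B∈x , ξ∈B = char⁺
          (B , (refine x⊆X (B , [ B∈x ]) , refl ,
                λ α∈ → char⁺ (char⁺ ((B , [ B∈x ]) , _ , α∈ , refl))) , ξ∈B)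

      module _ {A : 𝒫 ∣ κ ∣} (A∈J⁺ : A ∈ J ⁺) where

        Good : 𝒫 (Pκ κ ƛ)
        Good = char λ a → sup a ∈ ⟦ A ⟧ × sup a ∉ ⟦ Gen a ⟧

        -- Otherwise `A` would be covered by `Gen a` and a segment of `κ` reaching past `sup a`,
        -- both in `J`.
        fresh : ∀ a → ∃[ ξ ] (ξ ∈ ⟦ A ⟧ × ξ ∉ ⟦ Gen a ⟧ × (sup a < ξ))
        fresh a = byContradiction λ none →
          let γ , sup<γ = above (sup a) in
          A∈J⁺ (IsIdeal.subset (proj₁ J-ideal) {B = char (⟦ Gen a ⟧ ∪ ⟦ char (_< γ) ⟧)}
            (λ ξ∈A → char⁺ (byContradiction λ ξ∉ → none (_ , ξ∈A , ξ∉ ∘ inj₁ ,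
              <-≤-trans sup<γ (≮⇒≥ (ξ∉ ∘ inj₂ ∘ char⁺)))))
            (IsIdeal.union (proj₁ J-ideal) (char⁻ , char⁺) (Gen∈J a) (initial∈J J-ideal γ)))

        -- Added to `a`, the fresh ordinal becomes the supremum because it exceeds `sup a`, and
        -- lying in `κ` it contributes nothing to `Gen`.
        Good∈I⁺ : Good ∈ I κ ƛ ⁺
        Good∈I⁺ (a , disjoint) with fresh a
        ... | ξ , ξ∈A , ξ∉Gen , sup<ξ = disjoint b
            ( char⁺ ( subst (_∈ ⟦ A ⟧) (sym sup≡ξ) ξ∈A
                    , subst (_∉ ⟦ Gen b ⟧) (sym sup≡ξ) (ξ∉Gen ∘ Gen-mono b a b⊆a))
            , λ α∈a → char⁺ (inj₁ α∈a))
          where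
          b : Pκ κ ƛ
          b = mkPκ (⟦ value a ⟧ ∪ ｛ embed ξ ｝) (∪-Small (Pκ-Small a) (singleton-Small _))

          b⊆a : ∀ {α} → (∀ ξ → α ≢ embed ξ) → α ∈ ⟦ value b ⟧ → α ∈ ⟦ value a ⟧
          b⊆a α∉κ α∈b with char⁻ α∈b
          ... | inj₁ α∈a = α∈a
          ... | inj₂ ξ≡α = contradiction (sym ξ≡α) (α∉κ ξ)

          sup≡ξ : sup b ≡ ξ
          sup≡ξ = IsSup-unique b (sup-isSup b) λ η → mk⇔
            (λ η<ξ → ξ , char⁺ (inj₂ refl) , η<ξ)
            (λ (ζ , ζ∈b , η<ζ) → below (char⁻ ζ∈b) η<ζ)
            where
            below : ∀ {ζ η} → embed ζ ∈ ⟦ value a ⟧ ∪ ｛ embed ξ ｝ → η < ζ → η < ξ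
            below (inj₁ ζ∈a) η<ζ = <-trans (<sup {a} ζ∈a η<ζ) sup<ξ
            below (inj₂ ξ≡ζ) η<ζ = subst (_ <_) (sym (embed-injective ξ≡ζ)) η<ζ

        -- If `Gen a` covered the suprema, each `b` in `B` containing `a` would have `sup b` in
        -- `Gen a`, hence in `Gen b`, contrary to `Good`.
        sups∈J⁺ : ∀ {B} → B ∈ I κ ƛ ⁺ → ⟦ B ⟧ ⊆ ⟦ Good ⟧ →
                  char (λ ξ → ∃[ a ] (a ∈ ⟦ B ⟧ × sup a ≡ ξ)) ∈ J ⁺
        sups∈J⁺ {B} B∈I⁺ B⊆Good sups∈J = B∈I⁺ (a , disjoint)
          where
          a = proj₁ (Gen-cofinal sups∈J)

          disjoint : Empty (⟦ B ⟧ ∩ _⊑_ κ ƛ a)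
          disjoint b (b∈B , a⊑b) = proj₂ (char⁻ (B⊆Good b∈B))
            (Gen-mono a b (λ _ → a⊑b) (proj₂ (Gen-cofinal sups∈J) (char⁺ (b , b∈B , refl))))

      square : ∀ {ρ} → ∣ ρ ∣ → Squareκκ κ⊆ƛ ρ (I κ ƛ) → Square κ ρ J
      square {ρ} default I-square A A∈J⁺ f =
        Y , sups∈J⁺ A∈J⁺ Z∈I⁺ Z⊆Good , Y⊆A , λ universal → F-omits λ c → colour (universal c)
        where
        extend : ∀ p → Dec (p ∈ [_]² κ A) → ∣ ρ ∣
        extend p (yes p∈) = f (p , [ p∈ ])
        -- Any colour will do: pairs of suprema coming from `Good` lie in `A`.
        extend p (no _)   = default

        F : El ([_]²κκ κ⊆ƛ U) → ∣ ρ ∣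
        F p = extend (value p) em

        extend-yes : ∀ p (d : Dec (value p ∈ [_]² κ A)) → extend (value p) d ≡ f p
        extend-yes (p , _) (yes _) = refl
        extend-yes p       (no p∉) = contradiction (member p) p∉

        homogeneous = I-square F (Good A∈J⁺) (Good∈I⁺ A∈J⁺)
        Z = proj₁ homogeneous
        Z∈I⁺ = proj₁ (proj₂ homogeneous)

        Z⊆Good : ⟦ Z ⟧ ⊆ ⟦ Good A∈J⁺ ⟧
        Z⊆Good = proj₁ (proj₂ (proj₂ homogeneous))
        F-omits = proj₂ (proj₂ (proj₂ homogeneous))

        Y : 𝒫 ∣ κ ∣
        Y = char λ ξ → ∃[ a ] (a ∈ ⟦ Z ⟧ × sup a ≡ ξ)

        Y⊆A : ⟦ Y ⟧ ⊆ ⟦ A ⟧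
        Y⊆A ξ∈Y with char⁻ ξ∈Y
        ... | a , a∈Z , refl = proj₁ (char⁻ (Z⊆Good a∈Z))

        colour : ∀ {c} → (f ″ [_]² κ Y) c → (F ″ [_]²κκ κ⊆ƛ ⟦ Z ⟧) c
        colour (p , (ξ∈Y , η∈Y , ξ<η) , fp≡c) with char⁻ ξ∈Y | char⁻ η∈Y
        ... | a , a∈Z , refl | b , b∈Z , refl =
          (value p , [ a , b , tt , tt , sup-isSup a , sup-isSup b , ξ<η ]) ,
          (a , b , a∈Z , b∈Z , sup-isSup a , sup-isSup b , ξ<η) ,
          trans (extend-yes p em) fp≡c

theorem15p1 :
    (∀ {ℓ} → ExcludedMiddle ℓ) → (∀ {a b} → Extensionality a b) →
    (κ ƛ ρ : Cardinal) → Regular κ → Uncountable κ →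
    ∣ κ ∣ ≺ ∣ ƛ ∣ → (κ⊆ƛ : InitialSegment κ ƛ) →
    Fin 2 ≼ ∣ ρ ∣ → ∣ ρ ∣ ≼ ∣ κ ∣ →
    (∀ H → IdealOnPκ κ ƛ H →
      ∀ μ ν → IsCof H μ → IsNon κ (Square κ ρ) ν → ∣ μ ∣ ≺ ∣ ν ∣ →
      Squareκκ κ⊆ƛ ρ H)
    ×
    (Squareκκ κ⊆ƛ ρ (I κ ƛ) →
      ∀ σ → σ ∈ 𝒦 κ ƛ →
      ∀ ν → IsNonBar κ (Square κ ρ) ν → ∣ σ ∣ ≺ ∣ ν ∣)
theorem15p1 em ext κ ƛ ρ regular uncountable κ≺ƛ κ⊆ƛ 2≼ρ _ =
  (λ H H-ideal μ ν → partition-below-non {ρ} {H} μ ν H-ideal) ,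
  λ I-square σ (_ , T , T⤖σ , T-sparse) ν
    ((J , J-ideal , ((X , X⊆J , X⤖ν , J⊆ , _) , _) , ¬square) , _) →
    -- If `ν` embeds into `σ`, the generating family of size `ν` can be coded in `T`, and `J` has
    -- the relation it was chosen to fail.
    Order.⋠⇒≺ ν λ ν≼σ →
      let s , s-avoids = shift {κ} {ƛ} regular uncountable κ≺ƛ embedding in
      ¬square (Coding.square s s-avoids {T} (λ a → proj₂ (T-sparse a)) {J} J-ideal {X} X⊆J
                             (⤖⇒≽ T⤖σ ↣-∘ (ν≼σ ↣-∘ ⤖⇒≼ X⤖ν)) J⊆
                             -- The default colour exists because `ρ` has at least two elements.
                             {ρ} (Injection.to 2≼ρ fzero) I-square)
  where
  open Classical em ext
  open Supremum regular κ⊆ƛ
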